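{- Let $n\ge 2$. The formulas $$g_{n-2}=(n-1)c_{n-1}^*-c_{n-2}^*$$ and $$g_{n-2}=-2n(n-1)c_n+2(n-1)c_{n-1}-c_{n-2}+\beta_{n-2}$$ for the number $g_{n-2}$ of $(n-2)$-gaps of a digital $n$-object are equivalent; that is, for every digital $n$-object $D$, $$(n-1)c_{n-1}^*-c_{n-2}^* = -2n(n-1)c_n+2(n-1)c_{n-1}-c_{n-2}+\beta_{n-2}.$$
   Context: A cell of $\mathbb{R}^n$ is a product $e=\prod_{j=1}^n I_j$ where, for each $j$, $I_j$ is either a closed interval $[x_j-\frac12,x_j+\frac12]$ or a singleton $\{x_j\pm\frac12\}$, with $x_j\in\mathbb{Z}$. Its dimension $\dim(e)$ is the number of non-degenerate factors; an $i$-cell is a cell of dimension $i$, and an $n$-cell is called an $n$-voxel. We write $e_1<e_2$ ($e_1$ bounds $e_2$) if $e_1\subseteq e_2$ and $\dim(e_1)<\dim(e_2)$. A digital $n$-object $D$ is a finite collection of $n$-voxels. Its $i$-cells are the $i$-cells contained in at least one voxel of $D$; $c_i$ is their number (so $c_n=|D|$). For an $i$-cell $e$ with $0\le i\le n-1$, the $i$-block $B_i(e)$ is the collection of all $n$-voxels $v$ with $e<v$ (there are $2^{n-i}$ of them). An $i$-cell $e$ of $D$ is free if not all voxels of $B_i(e)$ belong to $D$. $c_i^*$ is the number of free $i$-cells of $D$. $\beta_{n-2}$ is the number of $(n-2)$-blocks contained in $D$, i.e. the number of $(n-2)$-cells $e$ such that all voxels of $B_{n-2}(e)$ belong to $D$.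 Two distinct $n$-voxels $v_1,v_2$ are strictly $i$-adjacent if $v_1\cap v_2$ is an $i$-cell. For an $(n-2)$-cell $e$, $D$ has an $(n-2)$-gap over $e$ if the set of voxels of $B_{n-2}(e)$ not belonging to $D$ consists of exactly two voxels $v_1,v_2$, which are strictly $(n-2)$-adjacent with $v_1\cap v_2=e$; $g_{n-2}$ is the number of such $e$. -}

module Defs where

open import Data.Empty using (⊥-elim)
open import Data.Integer.Base as ℤ using (ℤ; +_)
import Data.Integer.Properties as ℤ
open import Data.List.Base as List using (List; []; _∷_; length; filter; deduplicate; concatMap; cartesianProductWith)
import Data.List.Membership.DecPropositional as DecMembership
open import Data.List.Membership.Propositional using (_∈_; _∉_; find; lose)
open import Data.List.Membership.Propositional.Properties
  using (∈-filter⁺; ∈-filter⁻; ∈-deduplicate⁺; ∈-deduplicate⁻; ∈-concatMap⁺; ∈-cartesianProductWith⁺)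
open import Data.List.Relation.Unary.All as All using (All)
open import Data.List.Relation.Unary.Any as Any using (Any; here; there; any?)
open import Data.List.Relation.Unary.Unique.Propositional using (Unique)
import Data.List.Relation.Unary.Unique.Propositional.Properties as Unique
import Data.List.Relation.Unary.Unique.DecPropositional.Properties as DecUnique
open import Data.Nat.Base as ℕ using (ℕ; zero; suc; _∸_; _≤_; _<_; z≤n; s≤s)
import Data.Nat.Properties as ℕ
open import Data.Product.Base using (_×_; _,_; proj₁; proj₂; ∃; ∃₂)
open import Data.Rational.Base as ℚ using (ℚ; ½; 1ℚ)
import Data.Rational.Properties as ℚ
import Data.Rational.Unnormalised.Base as ℚᵘ
import Data.Rational.Unnormalised.Properties as ℚᵘ
open import Data.Sum.Base using (_⊎_; inj₁; inj₂)
open import Data.Vec.Base using (Vec; []; _∷_)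
import Data.Vec.Properties as Vec
open import Data.Vec.Relation.Binary.Pointwise.Inductive as Pointwise using (Pointwise; []; _∷_)
open import Function.Base using (_∘_)
open import Function.Bundles using (_⇔_; mk⇔; Equivalence)
open import Level using (0ℓ)
open import Relation.Binary.Definitions using (DecidableEquality)
open import Relation.Binary.PropositionalEquality
open import Relation.Nullary using (¬_; Dec; yes; no)
open import Relation.Nullary.Decidable using (map′; _×-dec_; _→-dec_; _⊎-dec_; ¬?)
open import Relation.Unary using (Pred; Decidable; _⊆_; _∩_; _∪_; _≐_; ｛_｝)

-- `interval x` is [x-½,x+½] and `point x` is {x+½}.  Since {x-½} is
-- `point (x-1)`, distinct codes denote distinct sets.

data Factor : Set where
  interval point : ℤ → Factor

Cell : ℕ → Set
Cell n = Vec Factor n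

-- There are no reals here.  All endpoints are rational, so inclusions and
-- intersections of cells may be tested on rational points.

Point : ℕ → Set
Point n = Vec ℚ n

fromℤ : ℤ → ℚ
fromℤ x = x ℚ./ 1

data _∈ᶠ_ (p : ℚ) : Factor → Set where
  interval : ∀ {x} → fromℤ x ℚ.- ½ ℚ.≤ p → p ℚ.≤ fromℤ x ℚ.+ ½ → p ∈ᶠ interval x
  point    : ∀ {x} → p ≡ fromℤ x ℚ.+ ½ → p ∈ᶠ point x

⟦_⟧ : ∀ {n} → Cell n → Pred (Point n) 0ℓ
⟦ e ⟧ p = Pointwise _∈ᶠ_ p e

dim : ∀ {n} → Cell n → ℕ
dim []               = 0
dim (interval _ ∷ e) = suc (dim e)
dim (point _    ∷ e) = dim e

IsVoxel : ∀ {n} → Pred (Cell n) 0ℓ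
IsVoxel {n} e = dim e ≡ n

infix 4 _<ᶜ_

_<ᶜ_ : ∀ {n} → Cell n → Cell n → Set
e₁ <ᶜ e₂ = ⟦ e₁ ⟧ ⊆ ⟦ e₂ ⟧ × dim e₁ < dim e₂

-- The i-block of an i-cell; i is determined by the cell.

Block : ∀ {n} → Cell n → Pred (Cell n) 0ℓ
Block e v = IsVoxel v × e <ᶜ v

StrictlyAdjacent : ∀ {n} → ℕ → Cell n → Cell n → Set
StrictlyAdjacent i v w = v ≢ w × ∃ λ e → dim e ≡ i × ⟦ v ⟧ ∩ ⟦ w ⟧ ≐ ⟦ e ⟧

record DigitalObject (n : ℕ) : Set where
  field
    voxels  : List (Cell n)
    isVoxel : All IsVoxel voxels
    unique  : Unique voxels

open DigitalObject public

module _ {n} (D : DigitalObject n) where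

  IsCellOf : ℕ → Pred (Cell n) 0ℓ
  IsCellOf i e = dim e ≡ i × ∃ λ v → v ∈ voxels D × ⟦ e ⟧ ⊆ ⟦ v ⟧

  BlockContained : Pred (Cell n) 0ℓ
  BlockContained e = Block e ⊆ (_∈ voxels D)

  IsFreeCellOf : ℕ → Pred (Cell n) 0ℓ
  IsFreeCellOf i e = IsCellOf i e × ¬ BlockContained e

  -- Here e ranges over all i-cells, not only over those of D.
  HasBlock : ℕ → Pred (Cell n) 0ℓ
  HasBlock i e = dim e ≡ i × BlockContained e

  Missing : Cell n → Pred (Cell n) 0ℓ
  Missing e v = Block e v × v ∉ voxels D

  HasGap : ℕ → Pred (Cell n) 0ℓ
  HasGap i e = dim e ≡ i × ∃₂ λ v w →
    Missing e ≐ ｛ v ｝ ∪ ｛ w ｝ × StrictlyAdjacent i v w × ⟦ v ⟧ ∩ ⟦ w ⟧ ≐ ⟦ e ⟧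

record Finite {A : Set} (P : Pred A 0ℓ) : Set where
  field
    elements   : List A
    unique     : Unique elements
    ∈-elements : ∀ {x} → x ∈ elements ⇔ P x

card : {A : Set} {P : Pred A 0ℓ} → Finite P → ℕ
card = length ∘ Finite.elements

finite : {A : Set} {P : Pred A 0ℓ} → DecidableEquality A → Decidable P →
         (xs : List A) → (∀ {x} → P x → x ∈ xs) → Finite P
finite _≟_ P? xs P⇒∈ = record
  { elements   = filter P? (deduplicate _≟_ xs)
  ; unique     = Unique.filter⁺ P? (DecUnique.deduplicate-! _≟_ xs)
  ; ∈-elements = mk⇔
      (λ x∈ → proj₂ (∈-filter⁻ P? {xs = deduplicate _≟_ xs} x∈))
      (λ px → ∈-filter⁺ P? (∈-deduplicate⁺ _≟_ (P⇒∈ px)) px)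
  }

fromℤ-cancel-≤ : ∀ {x y} → fromℤ x ℚ.≤ fromℤ y → x ℤ.≤ y
fromℤ-cancel-≤ {x} {y} x≤y = drop (ℚᵘ.≤-respˡ-≃ (ℚ.toℚᵘ-fromℚᵘ (ℚᵘ.mkℚᵘ x 0))
                                  (ℚᵘ.≤-respʳ-≃ (ℚ.toℚᵘ-fromℚᵘ (ℚᵘ.mkℚᵘ y 0)) (ℚ.toℚᵘ-mono-≤ x≤y)))
  where
  drop : ℚᵘ.mkℚᵘ x 0 ℚᵘ.≤ ℚᵘ.mkℚᵘ y 0 → x ℤ.≤ y
  drop (ℚᵘ.*≤* p) = subst₂ ℤ._≤_ (ℤ.*-identityʳ x) (ℤ.*-identityʳ y) p

fromℤ-suc : ∀ x → fromℤ x ℚ.+ 1ℚ ≡ fromℤ (ℤ.suc x)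
fromℤ-suc x = ℚ.toℚᵘ-injective (begin
  ℚ.toℚᵘ (fromℤ x ℚ.+ 1ℚ)            ≈⟨ ℚ.toℚᵘ-homo-+ (fromℤ x) 1ℚ ⟩
  ℚ.toℚᵘ (fromℤ x) ℚᵘ.+ ℚᵘ.1ℚᵘ       ≈⟨ ℚᵘ.+-congˡ ℚᵘ.1ℚᵘ (ℚ.toℚᵘ-fromℚᵘ (ℚᵘ.mkℚᵘ x 0)) ⟩
  ℚᵘ.mkℚᵘ x 0 ℚᵘ.+ ℚᵘ.1ℚᵘ            ≈⟨ ℚᵘ.*≡* (cong (ℤ._* + 1) (trans (cong (ℤ._+ + 1) (ℤ.*-identityʳ x)) (ℤ.+-comm x (+ 1)))) ⟩
  ℚᵘ.mkℚᵘ (ℤ.suc x) 0                ≈⟨ ℚ.toℚᵘ-fromℚᵘ (ℚᵘ.mkℚᵘ (ℤ.suc x) 0) ⟨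
  ℚ.toℚᵘ (fromℤ (ℤ.suc x))           ∎)
  where open ℚᵘ.≃-Reasoning

+r-r : ∀ p r → (p ℚ.+ r) ℚ.+ ℚ.- r ≡ p
+r-r p r = trans (ℚ.+-assoc p r (ℚ.- r)) (trans (cong (p ℚ.+_) (ℚ.+-inverseʳ r)) (ℚ.+-identityʳ p))

-r+r : ∀ p r → (p ℚ.+ ℚ.- r) ℚ.+ r ≡ p
-r+r p r = trans (ℚ.+-assoc p (ℚ.- r) r) (trans (cong (p ℚ.+_) (ℚ.+-inverseˡ r)) (ℚ.+-identityʳ p))

+½-cancel-≤ : ∀ {x y} → fromℤ x ℚ.+ ½ ℚ.≤ fromℤ y ℚ.+ ½ → x ℤ.≤ y
+½-cancel-≤ {x} {y} h = fromℤ-cancel-≤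
  (subst₂ ℚ._≤_ (+r-r (fromℤ x) ½) (+r-r (fromℤ y) ½) (ℚ.+-monoˡ-≤ (ℚ.- ½) h))

-½-cancel-≤ : ∀ {x y} → fromℤ x ℚ.- ½ ℚ.≤ fromℤ y ℚ.- ½ → x ℤ.≤ y
-½-cancel-≤ {x} {y} h = fromℤ-cancel-≤
  (subst₂ ℚ._≤_ (-r+r (fromℤ x) ½) (-r+r (fromℤ y) ½) (ℚ.+-monoˡ-≤ ½ h))

-½≤+½⇒≤suc : ∀ {x y} → fromℤ y ℚ.- ½ ℚ.≤ fromℤ x ℚ.+ ½ → y ℤ.≤ ℤ.suc x
-½≤+½⇒≤suc {x} {y} h = fromℤ-cancel-≤
  (subst₂ ℚ._≤_ (-r+r (fromℤ y) ½) (trans (ℚ.+-assoc (fromℤ x) ½ ½) (fromℤ-suc x)) (ℚ.+-monoˡ-≤ ½ h))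

lo hi : Factor → ℚ
lo (interval x) = fromℤ x ℚ.- ½
lo (point x)    = fromℤ x ℚ.+ ½
hi (interval x) = fromℤ x ℚ.+ ½
hi (point x)    = fromℤ x ℚ.+ ½

lo≤hi : ∀ F → lo F ℚ.≤ hi F
lo≤hi (interval x) = ℚ.+-monoʳ-≤ (fromℤ x) (ℚ.toℚᵘ-cancel-≤ (ℚᵘ.*≤* ℤ.-≤+))
lo≤hi (point x)    = ℚ.≤-refl

∈ᶠ⇒lo≤ : ∀ {p} F → p ∈ᶠ F → lo F ℚ.≤ p
∈ᶠ⇒lo≤ _ (interval l _) = l
∈ᶠ⇒lo≤ _ (point refl)   = ℚ.≤-refl

∈ᶠ⇒≤hi : ∀ {p} F → p ∈ᶠ F → p ℚ.≤ hi F
∈ᶠ⇒≤hi _ (interval _ h) = h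
∈ᶠ⇒≤hi _ (point refl)   = ℚ.≤-refl

bounds⇒∈ᶠ : ∀ {p} F → lo F ℚ.≤ p → p ℚ.≤ hi F → p ∈ᶠ F
bounds⇒∈ᶠ (interval x) l h = interval l h
bounds⇒∈ᶠ (point x)    l h = point (ℚ.≤-antisym h l)

lo∈ᶠ : ∀ F → lo F ∈ᶠ F
lo∈ᶠ F = bounds⇒∈ᶠ F ℚ.≤-refl (lo≤hi F)

hi∈ᶠ : ∀ F → hi F ∈ᶠ F
hi∈ᶠ F = bounds⇒∈ᶠ F (lo≤hi F) ℚ.≤-refl

nonempty : ∀ {n} (e : Cell n) → ∃ ⟦ e ⟧
nonempty []      = [] , []
nonempty (F ∷ e) = lo F ∷ proj₁ (nonempty e) , lo∈ᶠ F ∷ proj₂ (nonempty e)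

infix 4 _⊆ᶠ_ _⊆ᶠ?_

_⊆ᶠ_ : Factor → Factor → Set
F ⊆ᶠ G = (_∈ᶠ F) ⊆ (_∈ᶠ G)

_⊆ᶠ?_ : ∀ F G → Dec (F ⊆ᶠ G)
F ⊆ᶠ? G = map′
  (λ (l , h) p∈ → bounds⇒∈ᶠ G (ℚ.≤-trans l (∈ᶠ⇒lo≤ F p∈)) (ℚ.≤-trans (∈ᶠ⇒≤hi F p∈) h))
  (λ F⊆G → ∈ᶠ⇒lo≤ G (F⊆G (lo∈ᶠ F)) , ∈ᶠ⇒≤hi G (F⊆G (hi∈ᶠ F)))
  ((lo G ℚ.≤? lo F) ×-dec (hi F ℚ.≤? hi G))

⊆⇒pointwise : ∀ {n} {e f : Cell n} → ⟦ e ⟧ ⊆ ⟦ f ⟧ → Pointwise _⊆ᶠ_ e f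
⊆⇒pointwise {e = []}    {[]}    _   = []
⊆⇒pointwise {e = F ∷ e} {G ∷ f} e⊆f =
  (λ p∈ → Pointwise.head (e⊆f (p∈ ∷ proj₂ (nonempty e)))) ∷
  ⊆⇒pointwise (λ p∈ → Pointwise.tail (e⊆f (lo∈ᶠ F ∷ p∈)))

pointwise⇒⊆ : ∀ {n} {e f : Cell n} → Pointwise _⊆ᶠ_ e f → ⟦ e ⟧ ⊆ ⟦ f ⟧
pointwise⇒⊆ []           []        = []
pointwise⇒⊆ (F⊆G ∷ e⊆f) (p∈ ∷ ps∈) = F⊆G p∈ ∷ pointwise⇒⊆ e⊆f ps∈

_⊆?_ : ∀ {n} (e f : Cell n) → Dec (⟦ e ⟧ ⊆ ⟦ f ⟧)
e ⊆? f = map′ pointwise⇒⊆ ⊆⇒pointwise (Pointwise.decidable _⊆ᶠ?_ e f)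

data IsMeet : ∀ {n} → Cell n → Cell n → Cell n → Set where
  []  : IsMeet [] [] []
  _∷_ : ∀ {n F G H} {v w e : Cell n} →
        (_∈ᶠ F) ∩ (_∈ᶠ G) ≐ (_∈ᶠ H) → IsMeet v w e → IsMeet (F ∷ v) (G ∷ w) (H ∷ e)

isMeetᶠ? : ∀ F G H → Dec ((_∈ᶠ F) ∩ (_∈ᶠ G) ≐ (_∈ᶠ H))
isMeetᶠ? F G H = map′ to from
  (((H ⊆ᶠ? F) ×-dec (H ⊆ᶠ? G)) ×-dec
   ((lo H ℚ.≤? (lo F ℚ.⊔ lo G)) ×-dec ((hi F ℚ.⊓ hi G) ℚ.≤? hi H)))
  where
  L = lo F ℚ.⊔ lo G
  U = hi F ℚ.⊓ hi G

  inBoth : ∀ {p} → L ℚ.≤ p → p ℚ.≤ U → p ∈ᶠ F × p ∈ᶠ G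
  inBoth L≤p p≤U =
    bounds⇒∈ᶠ F (ℚ.≤-trans (ℚ.p≤p⊔q (lo F) (lo G)) L≤p) (ℚ.≤-trans p≤U (ℚ.p⊓q≤p (hi F) (hi G))) ,
    bounds⇒∈ᶠ G (ℚ.≤-trans (ℚ.p≤q⊔p (lo F) (lo G)) L≤p) (ℚ.≤-trans p≤U (ℚ.p⊓q≤q (hi F) (hi G)))

  to : (H ⊆ᶠ F × H ⊆ᶠ G) × (lo H ℚ.≤ L × U ℚ.≤ hi H) → (_∈ᶠ F) ∩ (_∈ᶠ G) ≐ (_∈ᶠ H)
  to ((H⊆F , H⊆G) , (l , h)) =
    (λ (p∈F , p∈G) → bounds⇒∈ᶠ H
      (ℚ.≤-trans l (ℚ.⊔-lub (∈ᶠ⇒lo≤ F p∈F) (∈ᶠ⇒lo≤ G p∈G)))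
      (ℚ.≤-trans (ℚ.⊓-glb (∈ᶠ⇒≤hi F p∈F) (∈ᶠ⇒≤hi G p∈G)) h)) ,
    (λ p∈H → H⊆F p∈H , H⊆G p∈H)

  from : (_∈ᶠ F) ∩ (_∈ᶠ G) ≐ (_∈ᶠ H) → (H ⊆ᶠ F × H ⊆ᶠ G) × (lo H ℚ.≤ L × U ℚ.≤ hi H)
  from (⊆H , H⊆) =
    ((λ p∈ → proj₁ (H⊆ p∈)) , (λ p∈ → proj₂ (H⊆ p∈))) ,
    (∈ᶠ⇒lo≤ H (⊆H (inBoth ℚ.≤-refl L≤U)) , ∈ᶠ⇒≤hi H (⊆H (inBoth L≤U ℚ.≤-refl)))
    where
    L≤U : L ℚ.≤ U
    L≤U = let (∈F , ∈G) = H⊆ (lo∈ᶠ H) in ℚ.≤-trans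
      (ℚ.⊔-lub (∈ᶠ⇒lo≤ F ∈F) (∈ᶠ⇒lo≤ G ∈G)) (ℚ.⊓-glb (∈ᶠ⇒≤hi F ∈F) (∈ᶠ⇒≤hi G ∈G))

isMeet⇒≐ : ∀ {n} {v w e : Cell n} → IsMeet v w e → ⟦ v ⟧ ∩ ⟦ w ⟧ ≐ ⟦ e ⟧
isMeet⇒≐ [] = (λ { ([] , []) → [] }) , (λ { [] → [] , [] })
isMeet⇒≐ ((⊆H , H⊆) ∷ m) with isMeet⇒≐ m
... | ⊆e , e⊆ =
  (λ { (p ∷ ps , q ∷ qs) → ⊆H (p , q) ∷ ⊆e (ps , qs) }) ,
  (λ { (p ∷ ps) → (proj₁ (H⊆ p) ∷ proj₁ (e⊆ ps)) , (proj₂ (H⊆ p) ∷ proj₂ (e⊆ ps)) })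

≐⇒isMeet : ∀ {n} {v w e : Cell n} → ⟦ v ⟧ ∩ ⟦ w ⟧ ≐ ⟦ e ⟧ → IsMeet v w e
≐⇒isMeet {v = []}    {[]}    {[]}    _         = []
≐⇒isMeet {v = F ∷ v} {G ∷ w} {H ∷ e} (⊆e , e⊆) =
  ( (λ (p , q) → let (ps , qs) = e⊆ (lo∈ᶠ H ∷ proj₂ (nonempty e)) in
      Pointwise.head (⊆e (p ∷ Pointwise.tail ps , q ∷ Pointwise.tail qs)))
  , (λ p → let (ps , qs) = e⊆ (p ∷ proj₂ (nonempty e)) in Pointwise.head ps , Pointwise.head qs) ) ∷
  ≐⇒isMeet
  ( (λ (ps , qs) → let (p , q) = e⊆ (lo∈ᶠ H ∷ proj₂ (nonempty e)) in
      Pointwise.tail (⊆e (Pointwise.head p ∷ ps , Pointwise.head q ∷ qs)))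
  , (λ ps → let (p , q) = e⊆ (lo∈ᶠ H ∷ ps) in Pointwise.tail p , Pointwise.tail q) )

isMeet? : ∀ {n} (v w e : Cell n) → Dec (IsMeet v w e)
isMeet? []      []      []      = yes []
isMeet? (F ∷ v) (G ∷ w) (H ∷ e) = map′ (λ (m , ms) → m ∷ ms) (λ { (m ∷ ms) → m , ms })
  (isMeetᶠ? F G H ×-dec isMeet? v w e)

∩≐? : ∀ {n} (v w e : Cell n) → Dec (⟦ v ⟧ ∩ ⟦ w ⟧ ≐ ⟦ e ⟧)
∩≐? v w e = map′ isMeet⇒≐ ≐⇒isMeet (isMeet? v w e)

_≟ᶠ_ : DecidableEquality Factor
interval x ≟ᶠ interval y = map′ (cong interval) (λ { refl → refl }) (x ℤ.≟ y)
interval x ≟ᶠ point y    = no λ ()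
point x    ≟ᶠ interval y = no λ ()
point x    ≟ᶠ point y    = map′ (cong point) (λ { refl → refl }) (x ℤ.≟ y)

_≟ᶜ_ : ∀ {n} → DecidableEquality (Cell n)
_≟ᶜ_ = Vec.≡-dec _≟ᶠ_

_∈?_ : ∀ {n} (e : Cell n) (es : List (Cell n)) → Dec (e ∈ es)
_∈?_ = DecMembership._∈?_ _≟ᶜ_

dim≤n : ∀ {n} (e : Cell n) → dim e ≤ n
dim≤n []               = z≤n
dim≤n (interval _ ∷ e) = s≤s (dim≤n e)
dim≤n (point _    ∷ e) = ℕ.m≤n⇒m≤1+n (dim≤n e)

point-notVoxel : ∀ {n x} {e : Cell n} → ¬ IsVoxel (point x ∷ e)
point-notVoxel {e = e} d = ℕ.<-irrefl d (s≤s (dim≤n e))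

interval⊆interval : ∀ {x y} → interval x ⊆ᶠ interval y → x ≡ y
interval⊆interval {x} {y} s = ℤ.≤-antisym
  (+½-cancel-≤ {x} {y} (∈ᶠ⇒≤hi (interval y) (s (hi∈ᶠ (interval x)))))
  (-½-cancel-≤ {y} {x} (∈ᶠ⇒lo≤ (interval y) (s (lo∈ᶠ (interval x)))))

point⊆interval : ∀ {x y} → point x ⊆ᶠ interval y → y ≡ x ⊎ y ≡ ℤ.suc x
point⊆interval {x} {y} s with y ℤ.≟ x
... | yes y≡x = inj₁ y≡x
... | no  y≢x = inj₂ (ℤ.≤-antisym
  (-½≤+½⇒≤suc {x} {y} (∈ᶠ⇒lo≤ (interval y) (s (lo∈ᶠ (point x)))))
  (ℤ.i<j⇒suc[i]≤j (ℤ.≤∧≢⇒< (+½-cancel-≤ {x} {y} (∈ᶠ⇒≤hi (interval y) (s (hi∈ᶠ (point x))))) (y≢x ∘ sym))))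

faces : ∀ {n} → Cell n → List (Cell n)
faces []               = [] ∷ []
faces (interval x ∷ v) =
  cartesianProductWith _∷_ (interval x ∷ point x ∷ point (ℤ.pred x) ∷ []) (faces v)
faces (point x    ∷ v) = List.map (point x ∷_) (faces v)

⊆⇒∈faces : ∀ {n} {e v : Cell n} → IsVoxel v → ⟦ e ⟧ ⊆ ⟦ v ⟧ → e ∈ faces v
⊆⇒∈faces d e⊆v = go d (⊆⇒pointwise e⊆v)
  where
  go : ∀ {n} {e v : Cell n} → IsVoxel v → Pointwise _⊆ᶠ_ e v → e ∈ faces v
  go {v = []}             d []        = here refl
  go {v = point y ∷ v}    d _         = ⊥-elim (point-notVoxel {x = y} {v} d)
  go {e = F ∷ _} {interval y ∷ v} d (s ∷ ss) =
    ∈-cartesianProductWith⁺ _∷_ (face F s) (go (ℕ.suc-injective d) ss)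
    where
    face : ∀ F → F ⊆ᶠ interval y → F ∈ interval y ∷ point y ∷ point (ℤ.pred y) ∷ []
    face (interval x) s = here (cong interval (interval⊆interval {x} {y} s))
    face (point x)    s with point⊆interval {x} {y} s
    ... | inj₁ refl = there (here refl)
    ... | inj₂ refl = there (there (here (cong point (sym (ℤ.pred-suc x)))))

cofaces : ∀ {n} → Cell n → List (Cell n)
cofaces []               = [] ∷ []
cofaces (interval x ∷ e) = cartesianProductWith _∷_ (interval x ∷ []) (cofaces e)
cofaces (point x    ∷ e) =
  cartesianProductWith _∷_ (interval x ∷ interval (ℤ.suc x) ∷ []) (cofaces e)

⊆⇒∈cofaces : ∀ {n} {e v : Cell n} → IsVoxel v → ⟦ e ⟧ ⊆ ⟦ v ⟧ → v ∈ cofaces e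
⊆⇒∈cofaces d e⊆v = go d (⊆⇒pointwise e⊆v)
  where
  go : ∀ {n} {e v : Cell n} → IsVoxel v → Pointwise _⊆ᶠ_ e v → v ∈ cofaces e
  go {v = []}          d []                      = here refl
  go {v = point y ∷ v} d _                       = ⊥-elim (point-notVoxel {x = y} {v} d)
  go {e = interval x ∷ _} {interval y ∷ v} d (s ∷ ss) =
    ∈-cartesianProductWith⁺ _∷_ {xs = interval x ∷ []} (here (cong interval (sym (interval⊆interval {x} {y} s)))) (go (ℕ.suc-injective d) ss)
  go {e = point x ∷ _} {interval y ∷ v} d (s ∷ ss) =
    ∈-cartesianProductWith⁺ _∷_ coface (go (ℕ.suc-injective d) ss)
    where
    coface : interval y ∈ interval x ∷ interval (ℤ.suc x) ∷ []
    coface with point⊆interval {x} {y} s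
    ... | inj₁ refl = here refl
    ... | inj₂ refl = there (here refl)

block? : ∀ {n} (e : Cell n) → Decidable (Block e)
block? {n} e v = (dim v ℕ.≟ n) ×-dec ((e ⊆? v) ×-dec (dim e ℕ.<? dim v))

∈block⇒∈cofaces : ∀ {n} {e v : Cell n} → Block e v → v ∈ cofaces e
∈block⇒∈cofaces (d , e⊆v , _) = ⊆⇒∈cofaces d e⊆v

module _ {n} (D : DigitalObject n) where

  isCellOf? : ∀ i → Decidable (IsCellOf D i)
  isCellOf? i e = (dim e ℕ.≟ i) ×-dec
    map′ find (λ (_ , v∈ , e⊆v) → lose v∈ e⊆v) (any? (e ⊆?_) (voxels D))

  blockContained? : Decidable (BlockContained D)
  blockContained? e = map′
    (λ all b → All.lookup all (∈block⇒∈cofaces b) b)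
    (λ bc → All.tabulate (λ _ b → bc b))
    (All.all? (λ v → block? e v →-dec (v ∈? voxels D)) (cofaces e))

  isFreeCellOf? : ∀ i → Decidable (IsFreeCellOf D i)
  isFreeCellOf? i e = isCellOf? i e ×-dec ¬? (blockContained? e)

  hasBlock? : ∀ i → Decidable (HasBlock D i)
  hasBlock? i e = (dim e ℕ.≟ i) ×-dec blockContained? e

  missing? : ∀ e → Decidable (Missing D e)
  missing? e v = block? e v ×-dec ¬? (v ∈? voxels D)

  missing≐? : ∀ e v w → Dec (Missing D e ≐ ｛ v ｝ ∪ ｛ w ｝)
  missing≐? e v w = map′
    (λ (all , mv , mw) →
      (λ m → All.lookup all (∈block⇒∈cofaces (proj₁ m)) m) ,
      (λ { (inj₁ refl) → mv ; (inj₂ refl) → mw }))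
    (λ (⊆vw , vw⊆) → All.tabulate (λ _ m → ⊆vw m) , vw⊆ (inj₁ refl) , vw⊆ (inj₂ refl))
    (All.all? (λ u → missing? e u →-dec ((v ≟ᶜ u) ⊎-dec (w ≟ᶜ u))) (cofaces e)
      ×-dec (missing? e v ×-dec missing? e w))

  hasGap? : ∀ i → Decidable (HasGap D i)
  hasGap? i e = map′ to from ((dim e ℕ.≟ i) ×-dec
    any? (λ v → any? (λ w → missing≐? e v w ×-dec (¬? (v ≟ᶜ w) ×-dec ∩≐? v w e)) (cofaces e)) (cofaces e))
    where
    Gap : Cell n → Cell n → Set
    Gap v w = Missing D e ≐ ｛ v ｝ ∪ ｛ w ｝ × v ≢ w × ⟦ v ⟧ ∩ ⟦ w ⟧ ≐ ⟦ e ⟧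

    to : dim e ≡ i × Any (λ v → Any (Gap v) (cofaces e)) (cofaces e) → HasGap D i e
    to (d , a) with find a
    ... | v , _ , b with find b
    ... | w , _ , m , v≢w , ∩≐e = d , v , w , m , (v≢w , e , d , ∩≐e) , ∩≐e

    from : HasGap D i e → dim e ≡ i × Any (λ v → Any (Gap v) (cofaces e)) (cofaces e)
    from (d , v , w , m , (v≢w , _) , ∩≐e) = d ,
      lose (∈block⇒∈cofaces (proj₁ (proj₂ m (inj₁ refl))))
        (lose (∈block⇒∈cofaces (proj₁ (proj₂ m (inj₂ refl)))) (m , v≢w , ∩≐e))

-- Three distinct voxels of the block of a cell with at least two
-- degenerate factors.

upper lower mixed : ∀ {n} → Cell n → Cell n
upper []               = []
upper (interval x ∷ e) = interval x ∷ upper e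
upper (point x    ∷ e) = interval (ℤ.suc x) ∷ upper e
lower []               = []
lower (interval x ∷ e) = interval x ∷ lower e
lower (point x    ∷ e) = interval x ∷ lower e
mixed []               = []
mixed (interval x ∷ e) = interval x ∷ mixed e
mixed (point x    ∷ e) = interval x ∷ upper e

x≢suc : ∀ {x} → x ≢ ℤ.suc x
x≢suc eq = ℤ.<-irrefl eq (ℤ.suc[i]≤j⇒i<j ℤ.≤-refl)

head≡ : ∀ {n x y} {e f : Cell n} → _≡_ {A = Cell (suc n)} (interval x ∷ e) (interval y ∷ f) → x ≡ y
head≡ refl = refl

tail≡ : ∀ {n F G} {e f : Cell n} → _≡_ {A = Cell (suc n)} (F ∷ e) (G ∷ f) → e ≡ f
tail≡ refl = refl

lower≢upper : ∀ {n} (e : Cell n) → dim e < n → lower e ≢ upper e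
lower≢upper (interval x ∷ e) (s≤s d) eq = lower≢upper e d (tail≡ eq)
lower≢upper (point x    ∷ e) _       eq = x≢suc (head≡ eq)

mixed≢upper : ∀ {n} (e : Cell n) → dim e < n → mixed e ≢ upper e
mixed≢upper (interval x ∷ e) (s≤s d) eq = mixed≢upper e d (tail≡ eq)
mixed≢upper (point x    ∷ e) _       eq = x≢suc (head≡ eq)

lower≢mixed : ∀ {n} (e : Cell n) → suc (dim e) < n → lower e ≢ mixed e
lower≢mixed (interval x ∷ e) (s≤s d) eq = lower≢mixed e d (tail≡ eq)
lower≢mixed (point x    ∷ e) (s≤s d) eq = lower≢upper e d (tail≡ eq)

-½≤+½ : ∀ x → fromℤ x ℚ.- ½ ℚ.≤ fromℤ x ℚ.+ ½
-½≤+½ x = lo≤hi (interval x)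

point⊆same : ∀ x → point x ⊆ᶠ interval x
point⊆same x (point refl) = interval (-½≤+½ x) ℚ.≤-refl

suc-½ : ∀ x → fromℤ (ℤ.suc x) ℚ.- ½ ≡ fromℤ x ℚ.+ ½
suc-½ x = trans (cong (ℚ._- ½) (sym (fromℤ-suc x))) (ℚ.+-assoc (fromℤ x) 1ℚ (ℚ.- ½))

point⊆next : ∀ x → point x ⊆ᶠ interval (ℤ.suc x)
point⊆next x (point refl) = interval (ℚ.≤-reflexive (suc-½ x))
  (ℚ.≤-trans (ℚ.≤-reflexive (sym (suc-½ x))) (-½≤+½ (ℤ.suc x)))

⊆lower : ∀ {n} (e : Cell n) → Pointwise _⊆ᶠ_ e (lower e)
⊆lower []               = []
⊆lower (interval x ∷ e) = (λ p∈ → p∈) ∷ ⊆lower e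
⊆lower (point x    ∷ e) = point⊆same x ∷ ⊆lower e

⊆upper : ∀ {n} (e : Cell n) → Pointwise _⊆ᶠ_ e (upper e)
⊆upper []               = []
⊆upper (interval x ∷ e) = (λ p∈ → p∈) ∷ ⊆upper e
⊆upper (point x    ∷ e) = point⊆next x ∷ ⊆upper e

⊆mixed : ∀ {n} (e : Cell n) → Pointwise _⊆ᶠ_ e (mixed e)
⊆mixed []               = []
⊆mixed (interval x ∷ e) = (λ p∈ → p∈) ∷ ⊆mixed e
⊆mixed (point x    ∷ e) = point⊆same x ∷ ⊆upper e

lower-voxel : ∀ {n} (e : Cell n) → IsVoxel (lower e)
lower-voxel []               = refl
lower-voxel (interval x ∷ e) = cong suc (lower-voxel e)
lower-voxel (point x    ∷ e) = cong suc (lower-voxel e)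

upper-voxel : ∀ {n} (e : Cell n) → IsVoxel (upper e)
upper-voxel []               = refl
upper-voxel (interval x ∷ e) = cong suc (upper-voxel e)
upper-voxel (point x    ∷ e) = cong suc (upper-voxel e)

mixed-voxel : ∀ {n} (e : Cell n) → IsVoxel (mixed e)
mixed-voxel []               = refl
mixed-voxel (interval x ∷ e) = cong suc (mixed-voxel e)
mixed-voxel (point x    ∷ e) = cong suc (upper-voxel e)

inBlock : ∀ {n} {e v : Cell n} → dim e < n → IsVoxel v → Pointwise _⊆ᶠ_ e v → Block e v
inBlock d<n vox e⊆v = vox , pointwise⇒⊆ e⊆v , subst (_ <_) (sym vox) d<n

module _ {n} (D : DigitalObject n) where

  finiteCells : ∀ i → Finite (IsCellOf D i)
  finiteCells i = finite _≟ᶜ_ (isCellOf? D i) (concatMap faces (voxels D))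
    (λ (_ , v , v∈ , e⊆v) → ∈-concatMap⁺ faces (lose v∈ (⊆⇒∈faces (All.lookup (isVoxel D) v∈) e⊆v)))

  cellCandidates : ∀ {i e} → IsCellOf D i e → e ∈ Finite.elements (finiteCells i)
  cellCandidates {i} = Equivalence.from (Finite.∈-elements (finiteCells i))

  finiteFreeCells : ∀ i → Finite (IsFreeCellOf D i)
  finiteFreeCells i = finite _≟ᶜ_ (isFreeCellOf? D i) (Finite.elements (finiteCells i)) (cellCandidates ∘ proj₁)

  hasBlock⇒isCellOf : ∀ {i e} → i < n → HasBlock D i e → IsCellOf D i e
  hasBlock⇒isCellOf {e = e} i<n (refl , bc) =
    refl , lower e , bc (inBlock i<n (lower-voxel e) (⊆lower e)) , pointwise⇒⊆ (⊆lower e)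

  finiteBlocks : ∀ {i} → i < n → Finite (HasBlock D i)
  finiteBlocks {i} i<n = finite _≟ᶜ_ (hasBlock? D i) (Finite.elements (finiteCells i))
    (cellCandidates ∘ hasBlock⇒isCellOf i<n)

  hasGap⇒isCellOf : ∀ {i e} → suc i < n → HasGap D i e → IsCellOf D i e
  hasGap⇒isCellOf {e = e} i+1<n (refl , v , w , (⊆vw , _) , _)
    with lower e ∈? voxels D | mixed e ∈? voxels D | upper e ∈? voxels D
  ... | yes l∈ | _      | _      = refl , lower e , l∈ , pointwise⇒⊆ (⊆lower e)
  ... | no _   | yes m∈ | _      = refl , mixed e , m∈ , pointwise⇒⊆ (⊆mixed e)
  ... | no _   | no _   | yes u∈ = refl , upper e , u∈ , pointwise⇒⊆ (⊆upper e)
  ... | no l∉  | no m∉  | no u∉  = ⊥-elim (pigeonhole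
        (⊆vw (inBlock i<n (lower-voxel e) (⊆lower e) , l∉))
        (⊆vw (inBlock i<n (mixed-voxel e) (⊆mixed e) , m∉))
        (⊆vw (inBlock i<n (upper-voxel e) (⊆upper e) , u∉)))
    where
    i<n = ℕ.<-trans (ℕ.n<1+n _) i+1<n
    l≢m = lower≢mixed e i+1<n
    l≢u = lower≢upper e i<n
    m≢u = mixed≢upper e i<n

    pigeonhole : (v ≡ lower e ⊎ w ≡ lower e) → (v ≡ mixed e ⊎ w ≡ mixed e) →
                 ¬ (v ≡ upper e ⊎ w ≡ upper e)
    pigeonhole (inj₁ p) (inj₁ q) _        = l≢m (trans (sym p) q)
    pigeonhole (inj₂ p) (inj₂ q) _        = l≢m (trans (sym p) q)
    pigeonhole (inj₁ p) (inj₂ q) (inj₁ r) = l≢u (trans (sym p) r)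
    pigeonhole (inj₁ p) (inj₂ q) (inj₂ r) = m≢u (trans (sym q) r)
    pigeonhole (inj₂ p) (inj₁ q) (inj₁ r) = m≢u (trans (sym q) r)
    pigeonhole (inj₂ p) (inj₁ q) (inj₂ r) = l≢u (trans (sym p) r)

  finiteGaps : ∀ {i} → suc i < n → Finite (HasGap D i)
  finiteGaps {i} i+1<n = finite _≟ᶜ_ (hasGap? D i) (Finite.elements (finiteCells i))
    (cellCandidates ∘ hasGap⇒isCellOf i+1<n)

n-2+1<n : ∀ {n} → 2 ≤ n → suc (n ∸ 2) < n
n-2+1<n (s≤s (s≤s z≤n)) = ℕ.≤-refl

c c* : ∀ {n} → DigitalObject n → ℕ → ℕ
c  D i = card (finiteCells D i)
c* D i = card (finiteFreeCells D i)

-- For n = 1, where n ∸ 2 = 0, every point over which both voxels are missing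
-- would be a gap, so finiteness needs 2 ≤ n.

β g : ∀ {n} → 2 ≤ n → DigitalObject n → ℕ
β 2≤n D = card (finiteBlocks D (ℕ.<-trans (ℕ.n<1+n _) (n-2+1<n 2≤n)))
g 2≤n D = card (finiteGaps D (n-2+1<n 2≤n))

{-# OPTIONS --safe #-}

-- Both formulas follow from two counts.  A cell of D is either free or has its
-- whole block in D, so c_{n-2} = c*_{n-2} + β_{n-2}, and likewise for n-1.  An
-- (n-1)-cell lies between exactly two voxels, its lower and its upper one.
-- Every voxel is the lower voxel of n such cells and the upper voxel of n
-- others, so inclusion–exclusion on {e | lower e ∈ D} and {e | upper e ∈ D}
-- gives n c_n + n c_n = c_{n-1} + β_{n-1}, that is c*_{n-1} = 2 c_{n-1} - 2 n c_n.

module Submission where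

open import Defs
open import Data.Nat.Base using (ℕ; _∸_; _≤_)
open import Data.Integer.Base using (ℤ; +_; -_; _+_; _-_; _*_)
open import Data.Product.Base using (_×_)
open import Function.Bundles using (_⇔_)
open import Relation.Binary.PropositionalEquality using (_≡_)

open import Data.Empty using (⊥)
import Data.Integer.Base as ℤ
import Data.Integer.Properties as ℤ
open import Data.Integer.Tactic.RingSolver using (solve-∀)
open import Data.List.Base using (List; []; _∷_; _++_; length; map; concatMap)
open import Data.List.Membership.Propositional using (_∈_; find; lose)
import Data.List.Membership.DecPropositional as DecMembership
open import Data.List.Membership.Propositional.Properties
  using (∈-++⁺ˡ; ∈-++⁺ʳ; ∈-++⁻; ∈-map⁺; ∈-map⁻; ∈-concatMap⁺; ∈-concatMap⁻)
open import Data.List.Membership.Propositional.Properties.WithK using (unique∧set⇒bag)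
open import Data.List.Properties using (length-++; length-map)
open import Data.List.Relation.Binary.BagAndSetEquality using (∼bag⇒↭)
open import Data.List.Relation.Binary.Permutation.Propositional.Properties using (↭-length)
open import Data.List.Relation.Unary.All as All using (All; []; _∷_)
import Data.List.Relation.Unary.All.Properties as All
open import Data.List.Relation.Unary.AllPairs using ([]; _∷_)
open import Data.List.Relation.Unary.Any using (here; there)
open import Data.List.Relation.Unary.Unique.Propositional using (Unique)
import Data.List.Relation.Unary.Unique.Propositional.Properties as Unique
open import Data.Nat.Base as ℕ using (suc; z≤n; s≤s)
import Data.Nat.Properties as ℕ
open import Data.Product.Base as Product using (_,_; proj₁; proj₂)
open import Data.Sum.Base as Sum using (_⊎_; inj₁; inj₂; [_,_])
import Data.Vec.Properties as Vec
open import Data.Vec.Base using ([]; _∷_)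
open import Data.Vec.Relation.Binary.Pointwise.Inductive using (Pointwise; []; _∷_)
open import Function.Base using (_∘_; id)
open import Function.Bundles using (mk⇔; Equivalence)
open import Level using (0ℓ)
open import Relation.Binary.Definitions using (DecidableEquality)
open import Relation.Binary.PropositionalEquality
  using (refl; sym; trans; cong; cong₂; subst; module ≡-Reasoning)
open import Relation.Nullary using (Dec; yes; no; contradiction)
open import Relation.Nullary.Decidable as Decidable using (_×-dec_; ¬?)
open import Relation.Unary using (Pred; Decidable; _≐_; _∪_; _∩_; _∖_; _⊆_)

-- Cardinalities of finite predicates.

module _ {A : Set} where

  open Finite

  -- Duplicate-free lists with the same members are permutations of each other. Counts may thus be
  -- taken along whichever enumeration is convenient.
  card-cong : {P Q : Pred A 0ℓ} (p : Finite P) (q : Finite Q) → P ≐ Q → card p ≡ card q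
  card-cong p q (P⊆Q , Q⊆P) = ↭-length (∼bag⇒↭ (unique∧set⇒bag (unique p) (unique q)
    (mk⇔ (from q ∘ P⊆Q ∘ to p) (from p ∘ Q⊆P ∘ to q))))
    where
    to : {R : Pred A 0ℓ} (r : Finite R) → ∀ {x} → x ∈ elements r → R x
    to r = Equivalence.to (∈-elements r)
    from : {R : Pred A 0ℓ} (r : Finite R) → ∀ {x} → R x → x ∈ elements r
    from r = Equivalence.from (∈-elements r)

  finite-∪ : {P Q : Pred A 0ℓ} → Finite P → Finite Q → (∀ {x} → P x → Q x → ⊥) → Finite (P ∪ Q)
  finite-∪ p q disjoint = record
    { elements   = elements p ++ elements q
    ; unique     = Unique.++⁺ (unique p) (unique q)
        (λ (x∈p , x∈q) → disjoint (Equivalence.to (∈-elements p) x∈p) (Equivalence.to (∈-elements q) x∈q))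
    ; ∈-elements = mk⇔
        (Sum.map (Equivalence.to (∈-elements p)) (Equivalence.to (∈-elements q)) ∘ ∈-++⁻ (elements p))
        [ ∈-++⁺ˡ ∘ Equivalence.from (∈-elements p)
        , ∈-++⁺ʳ (elements p) ∘ Equivalence.from (∈-elements q) ]
    }

  card-disjoint-∪ : {P Q R : Pred A 0ℓ} (p : Finite P) (q : Finite Q) (r : Finite R) →
                    (∀ {x} → P x → Q x → ⊥) → R ≐ P ∪ Q → card r ≡ card p ℕ.+ card q
  card-disjoint-∪ p q r disjoint R≐P∪Q =
    trans (card-cong r (finite-∪ p q disjoint) R≐P∪Q) (length-++ (elements p))

  -- Both sides equal |P| + |Q ∖ P| + |S|: `Q` splits into `Q ∖ P` and `S`, and `R` into `P` and
  -- `Q ∖ P`.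
  inclusion-exclusion :
    DecidableEquality A → {P Q R S : Pred A 0ℓ} →
    (p : Finite P) (q : Finite Q) (r : Finite R) (s : Finite S) →
    R ≐ P ∪ Q → S ≐ P ∩ Q → card p ℕ.+ card q ≡ card r ℕ.+ card s
  inclusion-exclusion _≟_ {P} {Q} p q r s (R⊆ , ⊆R) (S⊆ , ⊆S) = begin
    card p ℕ.+ card q                ≡⟨ cong (card p ℕ.+_) (card-disjoint-∪ q∖p s q
                                          (λ (_ , ¬Px) Sx → ¬Px (proj₁ (S⊆ Sx))) (Q⊆ , [ proj₁ , proj₂ ∘ S⊆ ])) ⟩
    card p ℕ.+ (card q∖p ℕ.+ card s) ≡⟨ ℕ.+-assoc (card p) (card q∖p) (card s) ⟨
    card p ℕ.+ card q∖p ℕ.+ card s   ≡⟨ cong (ℕ._+ card s) (card-disjoint-∪ p q∖p r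
                                          (λ Px (_ , ¬Px) → ¬Px Px) (R⊆′ , [ ⊆R ∘ inj₁ , ⊆R ∘ inj₂ ∘ proj₁ ])) ⟨
    card r ℕ.+ card s                ∎
    where
    open ≡-Reasoning

    -- Searching the enumerations decides `P` and `Q`; this is where decidable equality enters.
    P? : Decidable P
    P? x = Decidable.map (∈-elements p) (DecMembership._∈?_ _≟_ x (elements p))

    Q? : Decidable Q
    Q? x = Decidable.map (∈-elements q) (DecMembership._∈?_ _≟_ x (elements q))

    q∖p : Finite (Q ∖ P)
    q∖p = finite _≟_ (λ x → Q? x ×-dec ¬? (P? x)) (elements q) (Equivalence.from (∈-elements q) ∘ proj₁)

    Q⊆ : Q ⊆ (Q ∖ P) ∪ _
    Q⊆ {x} Qx with P? x
    ... | yes Px = inj₂ (⊆S (Px , Qx))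
    ... | no ¬Px = inj₁ (Qx , ¬Px)

    R⊆′ : _ ⊆ P ∪ (Q ∖ P)
    R⊆′ {x} Rx with P? x
    ... | yes Px = inj₁ Px
    ... | no ¬Px with R⊆ Rx
    ...   | inj₁ Px = inj₁ Px
    ...   | inj₂ Qx = inj₂ (Qx , ¬Px)

-- Voxels around a cell.

-- A common form of `lower` (`s = id`) and `upper` (`s = suc`), so that one count serves both sides.
fill : (ℤ → ℤ) → ∀ {n} → Cell n → Cell n
fill s []               = []
fill s (interval x ∷ e) = interval x ∷ fill s e
fill s (point x    ∷ e) = interval (s x) ∷ fill s e

fill-id : ∀ {n} (e : Cell n) → fill id e ≡ lower e
fill-id []               = refl
fill-id (interval x ∷ e) = cong (interval x ∷_) (fill-id e)
fill-id (point x    ∷ e) = cong (interval x ∷_) (fill-id e)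

fill-suc : ∀ {n} (e : Cell n) → fill ℤ.suc e ≡ upper e
fill-suc []               = refl
fill-suc (interval x ∷ e) = cong (interval x ∷_) (fill-suc e)
fill-suc (point x    ∷ e) = cong (interval (ℤ.suc x) ∷_) (fill-suc e)

fill-voxel : ∀ s {n} (v : Cell n) → IsVoxel v → fill s v ≡ v
fill-voxel s []               _  = refl
fill-voxel s (interval x ∷ v) iv = cong (interval x ∷_) (fill-voxel s v (ℕ.suc-injective iv))
fill-voxel s (point x    ∷ v) iv = contradiction iv (point-notVoxel {x = x} {v})

-- Unit intervals with integer centres are never properly nested, so the factors agree one by one.
voxel-⊆ : ∀ {n} {v w : Cell n} → IsVoxel v → IsVoxel w → Pointwise _⊆ᶠ_ v w → v ≡ w
voxel-⊆ {v = []}             {[]}             _  _  _          = refl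
voxel-⊆ {v = point x ∷ v}                     iv _  _          = contradiction iv (point-notVoxel {x = x} {v})
voxel-⊆ {v = interval _ ∷ _} {point x ∷ w}    _  iw _          = contradiction iw (point-notVoxel {x = x} {w})
voxel-⊆ {v = interval x ∷ v} {interval y ∷ w} iv iw (s ∷ ss) =
  cong₂ _∷_ (cong interval (interval⊆interval {x} {y} s))
    (voxel-⊆ (ℕ.suc-injective iv) (ℕ.suc-injective iw) ss)

-- Exactly one factor of `e` is a point. There `v` has one of the two adjacent intervals; in every
-- other coordinate it agrees with `e`.
lower∨upper : ∀ {n} {e v : Cell n} → suc (dim e) ≡ n → IsVoxel v → Pointwise _⊆ᶠ_ e v →
              lower e ≡ v ⊎ upper e ≡ v
lower∨upper {e = _ ∷ _}          {point x ∷ v}    _  iv _        = contradiction iv (point-notVoxel {x = x} {v})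
lower∨upper {e = interval x ∷ e} {interval y ∷ v} de iv (s ∷ ss) with interval⊆interval {x} {y} s
... | refl = Sum.map (cong (interval x ∷_)) (cong (interval x ∷_))
               (lower∨upper (ℕ.suc-injective de) (ℕ.suc-injective iv) ss)
lower∨upper {e = point x ∷ e}    {interval y ∷ v} de iv (s ∷ ss) =
  Sum.map (λ { refl → cong (interval y ∷_) (trans (sym (fill-id e)) fill≡v) })
          (λ { refl → cong (interval y ∷_) (trans (sym (fill-suc e)) fill≡v) })
          (point⊆interval {x} {y} s)
  where
  -- The only point factor is already used, so the tail `e` is a voxel: `fill s` fixes it for every
  -- `s`, and inclusion makes it equal to `v`.
  fill≡v : ∀ {s} → fill s e ≡ v
  fill≡v {s} = trans (fill-voxel s e ie) (voxel-⊆ ie (ℕ.suc-injective iv) ss)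
    where ie = ℕ.suc-injective de

-- Incidences of voxels and facets, counted on one side.

-- point x is the upper end of interval (s x) for s = id and the lower end for
-- s = suc.  facets is meaningful on voxels only: its last clause is junk.
module Side (s d : ℤ → ℤ) (s∘d : ∀ x → s (d x) ≡ x) (d∘s : ∀ x → d (s x) ≡ x) where

  facets : ∀ {n} → Cell n → List (Cell n)
  facets []               = []
  facets (interval x ∷ v) = (point (d x) ∷ v) ∷ map (interval x ∷_) (facets v)
  facets (point _    ∷ _) = []

  -- Together with `facet⁺`, this shows `facets v` to be the fibre of `fill s` over the voxel `v`
  -- among cells of codimension one.
  facet⁻ : ∀ {n} {e : Cell n} v → IsVoxel v → e ∈ facets v → suc (dim e) ≡ n × fill s e ≡ v
  facet⁻ (interval x ∷ v) iv (here refl) =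
    cong suc (ℕ.suc-injective iv) ,
    cong₂ (λ y → interval y ∷_) (s∘d x) (fill-voxel s v (ℕ.suc-injective iv))
  facet⁻ (interval x ∷ v) iv (there e∈) with ∈-map⁻ (interval x ∷_) e∈
  ... | f , f∈ , refl = Product.map (cong suc) (cong (interval x ∷_)) (facet⁻ v (ℕ.suc-injective iv) f∈)

  facet⁺ : ∀ {n} (e : Cell n) → suc (dim e) ≡ n → e ∈ facets (fill s e)
  facet⁺ (interval x ∷ e) de = there (∈-map⁺ (interval x ∷_) (facet⁺ e (ℕ.suc-injective de)))
  facet⁺ (point x    ∷ e) de =
    here (cong₂ (λ y → point y ∷_) (sym (d∘s x)) (sym (fill-voxel s e (ℕ.suc-injective de))))

  facets-unique : ∀ {n} (v : Cell n) → Unique (facets v)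
  facets-unique []               = []
  facets-unique (interval x ∷ v) =
    -- The first facet begins with a point, all others with an interval.
    All.map⁺ (All.universal (λ _ ()) (facets v)) ∷ Unique.map⁺ Vec.∷-injectiveʳ (facets-unique v)
  facets-unique (point _    ∷ _) = []

  length-facets : ∀ {n} (v : Cell n) → IsVoxel v → length (facets v) ≡ n
  length-facets []               _  = refl
  length-facets (interval x ∷ v) iv =
    cong suc (trans (length-map (interval x ∷_) (facets v)) (length-facets v (ℕ.suc-injective iv)))
  length-facets (point x    ∷ v) iv = contradiction iv (point-notVoxel {x = x} {v})

  length-concatMap-facets : ∀ {n} {vs : List (Cell n)} → All IsVoxel vs →
                            length (concatMap facets vs) ≡ length vs ℕ.* n
  length-concatMap-facets []                 = refl
  length-concatMap-facets {vs = v ∷ _} (iv ∷ ivs) = trans (length-++ (facets v))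
    (cong₂ ℕ._+_ (length-facets v iv) (length-concatMap-facets ivs))

  module _ {m} (D : DigitalObject (suc m)) where

    Facet : Pred (Cell (suc m)) 0ℓ
    Facet e = dim e ≡ m × fill s e ∈ voxels D

    voxel : ∀ {v} → v ∈ voxels D → IsVoxel v
    voxel = All.lookup (isVoxel D)

    -- A facet listed for two voxels would have both as its `fill s`, making them equal.
    concatMap-facets-unique : ∀ {vs : List (Cell (suc m))} → All IsVoxel vs → Unique vs →
                              Unique (concatMap facets vs)
    concatMap-facets-unique []         []       = []
    concatMap-facets-unique {v ∷ vs} (iv ∷ ivs) (v∉ ∷ u) =
      Unique.++⁺ (facets-unique v) (concatMap-facets-unique ivs u) λ (e∈v , e∈vs) →
        let w , w∈ , e∈w = find (∈-concatMap⁻ facets e∈vs)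
        in All.lookup v∉ w∈
             (trans (sym (proj₂ (facet⁻ v iv e∈v))) (proj₂ (facet⁻ w (All.lookup ivs w∈) e∈w)))

    -- Listed voxel by voxel, so that the length can be read off as `suc m` per voxel.
    finiteFacets : Finite Facet
    finiteFacets = record
      { elements   = concatMap facets (voxels D)
      ; unique     = concatMap-facets-unique (isVoxel D) (unique D)
      ; ∈-elements = mk⇔
          (λ e∈ → let v , v∈ , e∈v = find (∈-concatMap⁻ facets e∈)
                      de , fill≡v  = facet⁻ v (voxel v∈) e∈v
                  in ℕ.suc-injective de , subst (_∈ voxels D) (sym fill≡v) v∈)
          (λ (de , v∈) → ∈-concatMap⁺ facets (lose v∈ (facet⁺ _ (cong suc de))))
      }

    card-facets : card finiteFacets ≡ length (voxels D) ℕ.* suc m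
    card-facets = length-concatMap-facets (isVoxel D)

module Lower = Side id id (λ _ → refl) (λ _ → refl)
module Upper = Side ℤ.suc ℤ.pred ℤ.suc-pred ℤ.pred-suc

-- Relations between the cell counts.

-- Decidability of `BlockContained` splits the cells of `D`. Conversely, a block inside `D` lies
-- over a cell of `D` because it contains the lower voxel of that cell.
c≡c*+blocks : ∀ {n i} (D : DigitalObject n) (i<n : i ℕ.< n) →
              c D i ≡ c* D i ℕ.+ card (finiteBlocks D i<n)
c≡c*+blocks {i = i} D i<n =
  card-disjoint-∪ (finiteFreeCells D i) (finiteBlocks D i<n) (finiteCells D i)
    (λ (_ , ¬bc) (_ , bc) → ¬bc bc)
    ( (λ {e} cell → split cell (blockContained? D e))
    , [ proj₁ , hasBlock⇒isCellOf D i<n ])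
  where
  split : ∀ {e} → IsCellOf D i e → Dec (BlockContained D e) → IsFreeCellOf D i e ⊎ HasBlock D i e
  split cell (yes bc) = inj₂ (proj₁ cell , bc)
  split cell (no ¬bc) = inj₁ (cell , ¬bc)

-- An `n`-cell inside a voxel of `D` is that voxel, so `voxels D` itself enumerates the `n`-cells.
c-top : ∀ {n} (D : DigitalObject n) → c D n ≡ length (voxels D)
c-top {n} D = card-cong (finiteCells D n)
  (record { elements = voxels D ; unique = unique D ; ∈-elements = mk⇔ id id })
  ( (λ (ie , v , v∈ , e⊆v) → subst (_∈ voxels D)
      (sym (voxel-⊆ ie (All.lookup (isVoxel D) v∈) (⊆⇒pointwise e⊆v))) v∈)
  , (λ {e} e∈ → All.lookup (isVoxel D) e∈ , e , e∈ , id))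

module _ {m} (D : DigitalObject (suc m)) where

  cells≐lower∪upper : IsCellOf D m ≐ Lower.Facet D ∪ Upper.Facet D
  cells≐lower∪upper =
    (λ {e} (de , v , v∈ , e⊆v) → Sum.map
      (λ eq → de , subst (_∈ voxels D) (sym (trans (fill-id e) eq)) v∈)
      (λ eq → de , subst (_∈ voxels D) (sym (trans (fill-suc e) eq)) v∈)
      (lower∨upper (cong suc de) (All.lookup (isVoxel D) v∈) (⊆⇒pointwise e⊆v))) ,
    λ {e} →
      [ (λ (de , v∈) → de , lower e , subst (_∈ voxels D) (fill-id e) v∈ , pointwise⇒⊆ (⊆lower e))
      , (λ (de , v∈) → de , upper e , subst (_∈ voxels D) (fill-suc e) v∈ , pointwise⇒⊆ (⊆upper e)) ]

  -- By `lower∨upper`, the block of an `m`-cell consists of its lower and upper voxels alone.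
  blocks≐lower∩upper : HasBlock D m ≐ Lower.Facet D ∩ Upper.Facet D
  blocks≐lower∩upper =
    (λ {e} (de , bc) →
      (de , subst (_∈ voxels D) (sym (fill-id e)) (bc (inBlock (ℕ.≤-reflexive (cong suc de)) (lower-voxel e) (⊆lower e)))) ,
      (de , subst (_∈ voxels D) (sym (fill-suc e)) (bc (inBlock (ℕ.≤-reflexive (cong suc de)) (upper-voxel e) (⊆upper e))))) ,
    λ {e} ((de , l∈) , (_ , u∈)) → de , λ (iv , e⊆v , _) →
      [ (λ eq → subst (_∈ voxels D) (trans (fill-id e) eq) l∈)
      , (λ eq → subst (_∈ voxels D) (trans (fill-suc e) eq) u∈) ]
      (lower∨upper (cong suc de) iv (⊆⇒pointwise e⊆v))

  -- Each side contributes `suc m` facets per voxel; a facet is counted twice exactly when both its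
  -- voxels lie in `D`.
  incidences : c D (suc m) ℕ.* suc m ℕ.+ c D (suc m) ℕ.* suc m ≡
               c D m ℕ.+ card (finiteBlocks D (ℕ.n<1+n m))
  incidences = trans
    (cong₂ ℕ._+_ (trans (cong (ℕ._* suc m) (c-top D)) (sym (Lower.card-facets D)))
                 (trans (cong (ℕ._* suc m) (c-top D)) (sym (Upper.card-facets D))))
    (inclusion-exclusion _≟ᶜ_ (Lower.finiteFacets D) (Upper.finiteFacets D)
      (finiteCells D m) (finiteBlocks D (ℕ.n<1+n m)) cells≐lower∪upper blocks≐lower∩upper)

  c*-facets : + c* D m ≡ + 2 * + c D m - + 2 * (+ suc m * + c D (suc m))
  c*-facets = begin
    + c* D m
      -- With c = c* + b, the free count is 2c - (c + b), and `incidences` evaluates c + b.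
      ≡⟨ eliminate (+ c* D m) (+ b) ⟩
    + 2 * (+ c* D m + + b) - ((+ c* D m + + b) + + b)
      ≡⟨ cong (λ z → + 2 * z - (z + + b)) (trans (sym (ℤ.pos-+ (c* D m) b)) (cong +_ (sym (c≡c*+blocks D (ℕ.n<1+n m))))) ⟩
    + 2 * + c D m - (+ c D m + + b)
      ≡⟨ cong (λ z → + 2 * + c D m - z) incidencesℤ ⟨
    + 2 * + c D m - (+ k * + suc m + + k * + suc m)
      ≡⟨ collect (+ c D m) (+ k) (+ suc m) ⟩
    + 2 * + c D m - + 2 * (+ suc m * + k) ∎
    where
    open ≡-Reasoning
    b = card (finiteBlocks D (ℕ.n<1+n m))
    k = c D (suc m)

    incidencesℤ : + k * + suc m + + k * + suc m ≡ + c D m + + b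
    incidencesℤ = trans (cong₂ _+_ (sym (ℤ.pos-* k (suc m))) (sym (ℤ.pos-* k (suc m))))
      (cong +_ incidences)

    eliminate : ∀ x y → x ≡ + 2 * (x + y) - ((x + y) + y)
    eliminate = solve-∀

    collect : ∀ x y z → + 2 * x - (y * z + y * z) ≡ + 2 * x - + 2 * (z * y)
    collect = solve-∀

-- Equivalence of the two gap formulas.

theorem27 : (n : ℕ) (2≤n : 2 ≤ n) (D : DigitalObject n) →
    let
    freeFormula : ℤ
    freeFormula = (+ n - + 1) * + c* D (n ∸ 1) - + c* D (n ∸ 2)
    blockFormula : ℤ
    blockFormula = - (+ 2 * + n * (+ n - + 1) * + c D n) + + 2 * (+ n - + 1) * + c D (n ∸ 1) - + c D (n ∸ 2) + + β 2≤n D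
    in
    freeFormula ≡ blockFormula ×
    ((+ g 2≤n D ≡ freeFormula) ⇔ (+ g 2≤n D ≡ blockFormula))
theorem27 n@(suc m@(suc l)) 2≤n@(s≤s (s≤s z≤n)) D =
  free≡block , mk⇔ (λ eq → trans eq free≡block) (λ eq → trans eq (sym free≡block))
  where
  open ≡-Reasoning

  -- Adding and subtracting `b` turns the free count `f` into `f + b`, the number of all cells of
  -- dimension n - 2.
  expand : ∀ N K c₂ c₁ f b → K * (+ 2 * c₁ - + 2 * (N * c₂)) - f ≡
           - (+ 2 * N * K * c₂) + + 2 * K * c₁ - (f + b) + b
  expand = solve-∀

  K = + n - + 1

  free≡block : K * + c* D m - + c* D l ≡
    - (+ 2 * + n * K * + c D n) + + 2 * K * + c D m - + c D l + + β 2≤n D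
  free≡block = begin
    K * + c* D m - + c* D l
      ≡⟨ cong (λ z → K * z - + c* D l) (c*-facets D) ⟩
    K * (+ 2 * + c D m - + 2 * (+ n * + c D n)) - + c* D l
      ≡⟨ expand (+ n) K (+ c D n) (+ c D m) (+ c* D l) (+ β 2≤n D) ⟩
    - (+ 2 * + n * K * + c D n) + + 2 * K * + c D m - (+ c* D l + + β 2≤n D) + + β 2≤n D
      ≡⟨ cong (λ z → - (+ 2 * + n * K * + c D n) + + 2 * K * + c D m - z + + β 2≤n D)
           -- The proof of `l < n` is the one in the definition of `β`, so the block count here is
           -- `β 2≤n D` by definition.
           (cong +_ (c≡c*+blocks D (ℕ.<-trans (ℕ.n<1+n l) (n-2+1<n 2≤n)))) ⟨
    - (+ 2 * + n * K * + c D n) + + 2 * K * + c D m - + c D l + + β 2≤n D ∎
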